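{- Let $\varphi$ be a DBI normal formula, let $k\ge1$ and $i_1,\dots,i_k\in\mathcal{A}$ with $i_j\neq i_{j+1}$ for all $j$, and let $\alpha_1,\dots,\alpha_k$ be the unique events of $\mathcal{U}_\varphi$ with $0\,Q^\varphi_{i_1}\alpha_1Q^\varphi_{i_2}\alpha_2\cdots Q^\varphi_{i_k}\alpha_k$. Then for every pointed Kripke model $(\mathcal{M},v)$: $\mathcal{M},v\vDash\widehat{B}_{i_1}\Bigl(\mathsf{pre}^\varphi(\alpha_1)\wedge\widehat{B}_{i_2}\bigl(\mathsf{pre}^\varphi(\alpha_2)\wedge\dots\widehat{B}_{i_k}\mathsf{pre}^\varphi(\alpha_k)\bigr)\Bigr)$ if and only if $\mathcal{M}\odot\mathcal{U}_\varphi,(v,0)\nvDash B_{i_1}\dots B_{i_k}\bot$.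
   Context: Agents $\mathcal{A}=\{1,\dots,n\}$, $n>1$; language $\mathcal{L}$: $\varphi ::= p \mid \neg\varphi \mid (\varphi\wedge\varphi)\mid B_i\varphi$, with $\top,\bot$ as usual and $\widehat{B}_i\varphi:=\neg B_i\neg\varphi$. Kripke model $\mathcal{M}=\langle S,R,V\rangle$ (nonempty $S$, $R_i\subseteq S\times S$, $V:\mathit{Prop}\to 2^S$), standard truth. Action model $\mathcal{U}=\langle E,Q,\mathsf{pre}\rangle$ (nonempty $E$, $Q_i\subseteq E\times E$, $\mathsf{pre}:E\to\mathcal{L}$). Pointed update of $(\mathcal{M},w)$ with $(\mathcal{U},\alpha)$, defined iff $\mathcal{M},w\vDash\mathsf{pre}(\alpha)$: with $T=\{(x,\beta)\in S\times E\mid\mathcal{M},x\vDash\mathsf{pre}(\beta)\}$, $\mathcal{M}\odot\mathcal{U}=\langle S^{\mathcal U},R^{\mathcal U},V^{\mathcal U}\rangle$ where $S^{\mathcal U}$ is the smallest subset of $T$ containing $(w,\alpha)$ closed under: $(x,\beta)\in S^{\mathcal U}$, $(u,\gamma)\in T$, $xR_iu$, $\beta Q_i\gamma$ imply $(u,\gamma)\in S^{\mathcal U}$; $R^{\mathcal U}_i$ relates $(x,\beta),(u,\gamma)\in S^{\mathcal U}$ iff $xR_iu$ and $\beta Q_i\gamma$; $V^{\mathcal U}(p)=\{(x,\beta)\in S^{\mathcal U}\mid x\in V(p)\}$. Target agents: $\mathsf{ta}(p)=\varnothing$, $\mathsf{ta}(\neg\phi)=\mathsf{ta}(\phi)$,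 $\mathsf{ta}(\phi\wedge\psi)=\mathsf{ta}(\phi)\cup\mathsf{ta}(\psi)$, $\mathsf{ta}(B_i\phi)=\{i\}$. DBI formulas: $\varphi ::= B_i\xi \mid B_i(\xi\wedge\varphi)\mid(\varphi\wedge\varphi)\mid B_i\varphi$, $\xi$ purely propositional. DBI normal: $B_i\xi$ always; $B_i\varphi$, $B_i(\xi\wedge\varphi)$ iff $\varphi$ DBI normal and $i\notin\mathsf{ta}(\varphi)$; $\varphi\wedge\psi$ iff both DBI normal and $\mathsf{ta}(\varphi)\cap\mathsf{ta}(\psi)=\varnothing$. Action model $\mathcal{U}_\varphi=\langle E^\varphi,Q^\varphi,\mathsf{pre}^\varphi\rangle$ for DBI normal $\varphi$, recursively; always $E^\varphi=\{0,-1\}\sqcup D^\varphi$, $\varnothing\ne D^\varphi\subseteq\{1,2,\dots\}$, $\mathsf{pre}^\varphi(0)=\mathsf{pre}^\varphi(-1)=\top$; $\underline{Q}_j:=Q_j\cap((E\setminus\{0\})\times(E\setminus\{0\}))$. (1) $\varphi=B_i\xi$: $D=\{m\}$, $\mathsf{pre}(m)=\xi$, $Q_j=\{(0,-1),(m,-1),(-1,-1)\}$ ($j\ne i$), $Q_i=\{(0,m),(m,m),(-1,-1)\}$. (2) $\varphi=B_i\psi$: fresh $m\ge1$, $m\notin D^\psi$; $D^\varphi=D^\psi\sqcup\{m\}$; $\mathsf{pre}^\varphi$ extends $\mathsf{pre}^\psi$ with $\mathsf{pre}^\varphi(m)=\top$; $Q^\varphi_j=\underline{Q}^\psi_j\cup\{(0,-1)\}\cup\{(m,k)\mid(0,k)\in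 Q^\psi_j\}$ ($j\ne i$); $Q^\varphi_i=\underline{Q}^\psi_i\cup\{(0,m),(m,m)\}$. (3) $\varphi=B_i(\xi\wedge\psi)$: as (2) but $\mathsf{pre}^\varphi(m)=\xi$. (4) $\varphi=\psi\wedge\theta$: with $D^\psi\cap D^\theta=\varnothing$, $D^\varphi=D^\psi\sqcup D^\theta$, $\mathsf{pre}^\varphi=\mathsf{pre}^\psi\cup\mathsf{pre}^\theta$, $Q^\varphi_j=\underline{Q}^\psi_j\cup\underline{Q}^\theta_j\cup\{(0,k)\mid(0,k)\in Q^\psi_j\cup Q^\theta_j, k\in D^\psi\sqcup D^\theta\}\cup\{(0,-1)\mid\text{no such }k\text{ exists}\}$. In $\mathcal{U}_\varphi$ every event has exactly one $Q^\varphi_j$-successor for each agent $j$. -}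

module Defs where

open import Data.Bool.Base using (if_then_else_)
open import Data.Fin.Base using (Fin)
import Data.Fin.Properties as Fin
open import Data.Integer.Base using (ℤ; 0ℤ; 1ℤ; -1ℤ; _≤_)
open import Data.Irrelevant using ([_])
open import Data.Nat.Base using (ℕ; suc)
open import Data.Product.Base using (Σ; ∃; ∃-syntax; _×_; _,_)
open import Data.Refinement.Base using (value; _,_; Refinement-syntax)
open import Data.Sum.Base using (inj₁; inj₂)
open import Data.Unit.Base using (⊤)
open import Data.Vec.Base using (Vec; []; _∷_; foldr′)
open import Level using (Level; 0ℓ) renaming (suc to lsuc)
open import Relation.Binary.Core using (Rel)
open import Relation.Binary.PropositionalEquality.Core using (_≡_; _≢_; refl)
open import Relation.Nullary using (¬_; does)
open import Relation.Unary using (Pred; _∈_; _∉_; _∪_; _∩_; ∅; ｛_｝; _⊥_)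

-- The grammar has no primitive constant, so ⊤ and ⊥ are abbreviations built
-- from some atom p₀.
module Doxastic (n : ℕ) (Atom : Set) (p₀ : Atom) where

  Agent : Set
  Agent = Fin n

  infix  9 ~_
  infixr 7 _∧_

  data Formula : Set where
    atom : Atom → Formula
    ~_   : Formula → Formula
    _∧_  : Formula → Formula → Formula
    B    : Agent → Formula → Formula

  ⊥ᶠ ⊤ᶠ : Formula
  ⊥ᶠ = atom p₀ ∧ ~ atom p₀
  ⊤ᶠ = ~ ⊥ᶠ

  B̂ : Agent → Formula → Formula
  B̂ i φ = ~ B i (~ φ)

  record KripkeModel (ℓ : Level) : Set (lsuc ℓ) where
    field
      S        : Set ℓ
      nonempty : S
      R        : Agent → Rel S ℓ
      V        : Atom → Pred S ℓ

  record ActionModel : Set₁ where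
    field
      E        : Set
      nonempty : E
      Q        : Agent → Rel E 0ℓ
      pre      : E → Formula

  PointedModel : (ℓ : Level) → Set (lsuc ℓ)
  PointedModel ℓ = Σ (KripkeModel ℓ) KripkeModel.S

  PointedActionModel : Set₁
  PointedActionModel = Σ ActionModel ActionModel.E

  infix 4 _⊨_ _⊭_

  _⊨_ : ∀ {ℓ} → PointedModel ℓ → Formula → Set ℓ
  (M , w) ⊨ atom p  = w ∈ KripkeModel.V M p
  (M , w) ⊨ ~ φ     = ¬ ((M , w) ⊨ φ)
  (M , w) ⊨ φ ∧ ψ   = ((M , w) ⊨ φ) × ((M , w) ⊨ ψ)
  (M , w) ⊨ B i φ   = ∀ u → KripkeModel.R M i w u → (M , u) ⊨ φ

  _⊭_ : ∀ {ℓ} → PointedModel ℓ → Formula → Set ℓ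
  Mw ⊭ φ = ¬ (Mw ⊨ φ)

  ⊨⊤ᶠ : ∀ {ℓ} (Mw : PointedModel ℓ) → Mw ⊨ ⊤ᶠ
  ⊨⊤ᶠ Mw (p , ¬p) = ¬p p

  module _ {ℓ : Level} (M : KripkeModel ℓ) (U : ActionModel) where
    open KripkeModel M
    open ActionModel U

    T : Pred (S × E) ℓ
    T (x , β) = (M , x) ⊨ pre β

    data Sᵁ (w : S) (α : E) : Pred (S × E) ℓ where
      base : (w , α) ∈ T → (w , α) ∈ Sᵁ w α
      step : ∀ {i x β u γ} → (x , β) ∈ Sᵁ w α → (u , γ) ∈ T →
             R i x u → Q i β γ → (u , γ) ∈ Sᵁ w α

  infix 5 _⊙_⟨_⟩

  -- The worlds are a refinement type, with irrelevant membership proofs, so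
  -- that a pair reachable in several ways still yields a single world.
  _⊙_⟨_⟩ : ∀ {ℓ} (Mw : PointedModel ℓ) ((U , α) : PointedActionModel) →
           Mw ⊨ ActionModel.pre U α → PointedModel ℓ
  (M , w) ⊙ (U , α) ⟨ w⊨pre ⟩ = updated , point
    where
    open KripkeModel M
    open ActionModel U hiding (nonempty)

    World : Set _
    World = [ xβ ∈ S × E ∣ xβ ∈ Sᵁ M U w α ]

    point : World
    point = (w , α) , [ base w⊨pre ]

    related : Agent → Rel (S × E) _
    related i (x , β) (u , γ) = R i x u × Q i β γ

    valuation : Atom → Pred (S × E) _
    valuation p (x , β) = x ∈ V p

    updated : KripkeModel _
    updated = record
      { S        = World
      ; nonempty = point
      ; R        = λ i s t → related i (value s) (value t)
      ; V        = λ p s → valuation p (value s)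
      }

  data Propositional : Pred Formula 0ℓ where
    atom : ∀ p → Propositional (atom p)
    ~_   : ∀ {φ} → Propositional φ → Propositional (~ φ)
    _∧_  : ∀ {φ ψ} → Propositional φ → Propositional ψ → Propositional (φ ∧ ψ)

  ta : Formula → Pred Agent 0ℓ
  ta (atom p) = ∅
  ta (~ φ)    = ta φ
  ta (φ ∧ ψ)  = ta φ ∪ ta ψ
  ta (B i φ)  = ｛ i ｝

  data DBI : Pred Formula 0ℓ where
    Bξ  : ∀ i {ξ} → Propositional ξ → DBI (B i ξ)
    Bξ∧ : ∀ i {ξ φ} → Propositional ξ → DBI φ → DBI (B i (ξ ∧ φ))
    _∧_ : ∀ {φ ψ} → DBI φ → DBI ψ → DBI (φ ∧ ψ)
    B   : ∀ i {φ} → DBI φ → DBI (B i φ)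

  Normal : ∀ {φ} → DBI φ → Set
  Normal (Bξ i ξ)            = ⊤
  Normal (Bξ∧ i {φ = φ} ξ d) = Normal d × i ∉ ta φ
  Normal (_∧_ {φ} {ψ} d e)   = Normal d × Normal e × ta φ ⊥ ta ψ
  Normal (B i {φ} d)         = Normal d × i ∉ ta φ

  -- A labelling records one admissible choice of the fresh positive event
  -- numbers m made along the recursion; D collects the numbers chosen.
  mutual
    data Labelling : ∀ {φ} → DBI φ → Set where
      Bξ   : ∀ {i ξ} {pξ : Propositional ξ} (m : ℤ) → 1ℤ ≤ m →
             Labelling (Bξ i pξ)
      Bξ∧  : ∀ {i ξ φ} {pξ : Propositional ξ} {d : DBI φ} →
             (l : Labelling d) (m : ℤ) → 1ℤ ≤ m → m ∉ D l →
             Labelling (Bξ∧ i pξ d)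
      conj : ∀ {φ ψ} {d : DBI φ} {e : DBI ψ} →
             (l : Labelling d) (l′ : Labelling e) → D l ⊥ D l′ →
             Labelling (d ∧ e)
      B    : ∀ {i φ} {d : DBI φ} →
             (l : Labelling d) (m : ℤ) → 1ℤ ≤ m → m ∉ D l →
             Labelling (B i d)

    D : ∀ {φ} {d : DBI φ} → Labelling d → Pred ℤ 0ℓ
    D (Bξ m _)      = ｛ m ｝
    D (Bξ∧ l m _ _) = D l ∪ ｛ m ｝
    D (conj l l′ _) = D l ∪ D l′
    D (B l m _ _)   = D l ∪ ｛ m ｝

  Events : ∀ {φ} {d : DBI φ} → Labelling d → Pred ℤ 0ℓ
  Events l = (｛ 0ℤ ｝ ∪ ｛ -1ℤ ｝) ∪ D l

  preᴰ : ∀ {φ} {d : DBI φ} (l : Labelling d) {k : ℤ} → k ∈ D l → Formula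
  preᴰ (Bξ {ξ = ξ} _ _)      _        = ξ
  preᴰ (Bξ∧ l _ _ _)         (inj₁ k) = preᴰ l k
  preᴰ (Bξ∧ {ξ = ξ} _ _ _ _) (inj₂ _) = ξ
  preᴰ (conj l _ _)          (inj₁ k) = preᴰ l k
  preᴰ (conj _ l′ _)         (inj₂ k) = preᴰ l′ k
  preᴰ (B l _ _ _)           (inj₁ k) = preᴰ l k
  preᴰ (B _ _ _ _)           (inj₂ _) = ⊤ᶠ

  preᴱ : ∀ {φ} {d : DBI φ} (l : Labelling d) {k : ℤ} → k ∈ Events l → Formula
  preᴱ l (inj₁ _) = ⊤ᶠ
  preᴱ l (inj₂ k) = preᴰ l k

  Arrows : Set₁
  Arrows = Pred (ℤ × ℤ) 0ℓ

  avoid0 : Arrows → Arrows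
  avoid0 Q = Q ∩ λ (x , y) → x ≢ 0ℤ × y ≢ 0ℤ

  -- The step common to B i ψ and B i (ξ ∧ ψ), from the arrows Q for ψ.
  prefix : Agent → ℤ → (Agent → Arrows) → Agent → Arrows
  prefix i m Q j = if does (j Fin.≟ i)
    then avoid0 (Q j) ∪ ｛ 0ℤ , m ｝ ∪ ｛ m , m ｝
    else avoid0 (Q j) ∪ ｛ 0ℤ , -1ℤ ｝ ∪ λ (x , k) → x ≡ m × (0ℤ , k) ∈ Q j

  arrows : ∀ {φ} {d : DBI φ} → Labelling d → Agent → Arrows
  arrows (Bξ {i} m _) j = if does (j Fin.≟ i)
    then ｛ 0ℤ , m ｝ ∪ ｛ m , m ｝ ∪ ｛ -1ℤ , -1ℤ ｝
    else ｛ 0ℤ , -1ℤ ｝ ∪ ｛ m , -1ℤ ｝ ∪ ｛ -1ℤ , -1ℤ ｝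
  arrows (Bξ∧ {i} l m _ _) = prefix i m (arrows l)
  arrows (B {i} l m _ _)   = prefix i m (arrows l)
  arrows (conj l l′ _) j   =
    avoid0 (arrows l j) ∪ avoid0 (arrows l′ j)
    ∪ (λ (x , k) → x ≡ 0ℤ × Target k)
    ∪ (λ (x , y) → x ≡ 0ℤ × y ≡ -1ℤ × ¬ (∃[ k ] Target k))
    where
    Target : Pred ℤ 0ℓ
    Target k = (0ℤ , k) ∈ arrows l j ∪ arrows l′ j × k ∈ D l ∪ D l′

  event0 : ∀ {φ} {d : DBI φ} (l : Labelling d) → ∃ (Events l)
  event0 l = 0ℤ , inj₁ (inj₁ refl)

  𝒰 : ∀ {φ} {d : DBI φ} → Labelling d → ActionModel
  𝒰 l = record
    { E        = ∃ (Events l)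
    ; nonempty = event0 l
    ; Q        = λ j (x , _) (y , _) → (x , y) ∈ arrows l j
    ; pre      = λ (_ , k) → preᴱ l k
    }

  -- Path U β (i₁ ∷ … ∷ iₖ) (α₁ ∷ … ∷ αₖ)  is  β Q_{i₁} α₁ Q_{i₂} ⋯ Q_{iₖ} αₖ.
  Path : (U : ActionModel) → let open ActionModel U in
         ∀ {k} → E → Vec Agent k → Vec E k → Set
  Path U β []       []       = ⊤
  Path U β (i ∷ is) (α ∷ αs) = ActionModel.Q U i β α × Path U α is αs

  -- B̂_{i₁} (φ₁ ∧ B̂_{i₂} (φ₂ ∧ ⋯ B̂_{iₖ} φₖ))
  B̂-nest : ∀ {k} → Vec Agent (suc k) → Vec Formula (suc k) → Formula
  B̂-nest (i ∷ [])         (φ ∷ [])         = B̂ i φ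
  B̂-nest (i ∷ is@(_ ∷ _)) (φ ∷ φs@(_ ∷ _)) = B̂ i (φ ∧ B̂-nest is φs)

  B-seq : ∀ {k} → Vec Agent k → Formula → Formula
  B-seq is φ = foldr′ B φ is

{-# OPTIONS --safe #-}

-- In 𝒰 l every event has at most one successor per agent; this is where
-- normality enters, as it stops the two halves of a conjunction from both
-- giving event 0 a positive successor for the same agent.  For any such
-- action model, the worlds of the update reached from (v , β) along
-- i₁ ⋯ iₖ are exactly the (u , αₖ) with v R_{i₁} u₁ ⋯ R_{iₖ} u and every
-- uⱼ ⊨ pre αⱼ, whence the equivalence by induction on k.  It holds
-- constructively because both sides are negated statements: B i₁ ⋯ B iₖ ⊥ is
-- stable under double negation.
module Submission where

open import Defs
open import Data.Empty using (⊥-elim)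
import Data.Fin.Properties as Fin
open import Data.Integer.Base using (ℤ; 0ℤ; 1ℤ; -1ℤ; _≤_; +≤+)
open import Data.Irrelevant using ([_])
open import Data.Nat.Base using (ℕ; suc; _>_)
open import Data.Product.Base using (_×_; _,_; proj₁; proj₂)
open import Data.Refinement.Base using (_,_)
open import Data.Sum.Base using (inj₁; inj₂; map₂)
open import Data.Vec.Base using (Vec; []; _∷_; map)
open import Data.Vec.Relation.Unary.Linked using (Linked)
open import Function.Base using (case_of_)
open import Function.Bundles using (_⇔_; mk⇔)
open import Level using (Level; 0ℓ)
open import Relation.Binary.PropositionalEquality using (_≡_; _≢_; refl; cong; sym; trans)
open import Relation.Nullary using (¬_; yes; no; contradiction)
open import Relation.Nullary.Negation using (contradiction-irr)
open import Relation.Unary using (Pred; _∈_; _∉_; _∪_; ｛_｝; _⊥_; _⊆_; Irrelevant)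

-- Positive labels and uniqueness of membership proofs.

Positive : Pred ℤ 0ℓ
Positive = 1ℤ ≤_

0∉Positive : 0ℤ ∉ Positive
0∉Positive (+≤+ ())

-1∉Positive : -1ℤ ∉ Positive
-1∉Positive ()

-- Disjointness excludes the mixed cases, where one integer would have both an `inj₁` and an `inj₂`
-- proof. An event pairs an integer with such a proof, so equal integers give equal events only if
-- these proofs are unique.
∪-irrelevant : (X Y : Pred ℤ 0ℓ) → Irrelevant X → Irrelevant Y → X ⊥ Y →
               Irrelevant (X ∪ Y)
∪-irrelevant X Y irrX irrY X⊥Y (inj₁ p) (inj₁ q) = cong inj₁ (irrX p q)
∪-irrelevant X Y irrX irrY X⊥Y (inj₁ p) (inj₂ q) = ⊥-elim (X⊥Y (p , q))
∪-irrelevant X Y irrX irrY X⊥Y (inj₂ p) (inj₁ q) = ⊥-elim (X⊥Y (q , p))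
∪-irrelevant X Y irrX irrY X⊥Y (inj₂ p) (inj₂ q) = cong inj₂ (irrY p q)

｛｝-irrelevant : (m : ℤ) → Irrelevant ｛ m ｝
｛｝-irrelevant m refl refl = refl

∉⇒⊥｛｝ : (X : Pred ℤ 0ℓ) {m : ℤ} → m ∉ X → X ⊥ ｛ m ｝
∉⇒⊥｛｝ X m∉X (p , refl) = m∉X p

module _ {n : ℕ} {Atom : Set} {p₀ : Atom} where
  open Doxastic n Atom p₀

  D⊆Positive : ∀ {φ} {d : DBI φ} (l : Labelling d) → D l ⊆ Positive
  D⊆Positive (Bξ m 1≤m)      refl        = 1≤m
  D⊆Positive (Bξ∧ l m 1≤m _) (inj₁ k∈D)  = D⊆Positive l k∈D
  D⊆Positive (Bξ∧ l m 1≤m _) (inj₂ refl) = 1≤m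
  D⊆Positive (conj l l′ _)   (inj₁ k∈D)  = D⊆Positive l k∈D
  D⊆Positive (conj l l′ _)   (inj₂ k∈D)  = D⊆Positive l′ k∈D
  D⊆Positive (B l m 1≤m _)   (inj₁ k∈D)  = D⊆Positive l k∈D
  D⊆Positive (B l m 1≤m _)   (inj₂ refl) = 1≤m

  D-irrelevant : ∀ {φ} {d : DBI φ} (l : Labelling d) → Irrelevant (D l)
  D-irrelevant (Bξ m _) = ｛｝-irrelevant m
  D-irrelevant (Bξ∧ l m _ m∉D) =
    ∪-irrelevant (D l) ｛ m ｝ (D-irrelevant l) (｛｝-irrelevant m) (∉⇒⊥｛｝ (D l) m∉D)
  D-irrelevant (conj l l′ disj) =
    ∪-irrelevant (D l) (D l′) (D-irrelevant l) (D-irrelevant l′) disj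
  D-irrelevant (B l m _ m∉D) =
    ∪-irrelevant (D l) ｛ m ｝ (D-irrelevant l) (｛｝-irrelevant m) (∉⇒⊥｛｝ (D l) m∉D)

  Events-irrelevant : ∀ {φ} {d : DBI φ} (l : Labelling d) → Irrelevant (Events l)
  Events-irrelevant l =
    ∪-irrelevant (｛ 0ℤ ｝ ∪ ｛ -1ℤ ｝) (D l)
      (∪-irrelevant ｛ 0ℤ ｝ ｛ -1ℤ ｝ (｛｝-irrelevant 0ℤ) (｛｝-irrelevant -1ℤ) λ { (refl , ()) })
      (D-irrelevant l)
      λ { (inj₁ refl , 0∈D)  → 0∉Positive (D⊆Positive l 0∈D)
        ; (inj₂ refl , -1∈D) → -1∉Positive (D⊆Positive l -1∈D) }

  -- Where arrows can start, and the sink event -1.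

  Functional : Arrows → Set
  Functional A = ∀ {x y z} → (x , y) ∈ A → (x , z) ∈ A → y ≡ z

  -- The invariant that lets arrow sets be glued. With `X` the set of labels, arrows that survive
  -- `avoid0` start in `X` or at -1, so arrow sets over disjoint labels share at most the source -1,
  -- where `sink` makes them agree.
  record Confined (X : Pred ℤ 0ℓ) (A : Arrows) : Set where
    field
      source : ∀ {x y} → (x , y) ∈ A → x ≢ 0ℤ → x ∈ ｛ -1ℤ ｝ ∪ X
      sink   : ∀ {y} → (-1ℤ , y) ∈ A → y ≡ -1ℤ

  prefix-confined : ∀ i {m} Q j {X} → Positive m → Confined X (Q j) →
                    Confined (X ∪ ｛ m ｝) (prefix i m Q j)
  prefix-confined i {m} Q j {X} 1≤m c with j Fin.≟ i
  ... | yes _ = record { source = src ; sink = snk }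
    where
    open Confined c
    A : Arrows
    A = avoid0 (Q j) ∪ ｛ 0ℤ , m ｝ ∪ ｛ m , m ｝
    src : ∀ {x y} → (x , y) ∈ A → x ≢ 0ℤ → x ∈ ｛ -1ℤ ｝ ∪ (X ∪ ｛ m ｝)
    src (inj₁ (q , _))     x≢0 = map₂ inj₁ (source q x≢0)
    src (inj₂ (inj₁ refl)) x≢0 = contradiction refl x≢0
    src (inj₂ (inj₂ refl)) x≢0 = inj₂ (inj₂ refl)
    snk : ∀ {y} → (-1ℤ , y) ∈ A → y ≡ -1ℤ
    snk (inj₁ (q , _))     = sink q
    snk (inj₂ (inj₂ refl)) = contradiction 1≤m -1∉Positive
  ... | no _ = record { source = src ; sink = snk }
    where
    open Confined c
    A : Arrows
    A = avoid0 (Q j) ∪ ｛ 0ℤ , -1ℤ ｝ ∪ λ (x , k) → x ≡ m × (0ℤ , k) ∈ Q j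
    src : ∀ {x y} → (x , y) ∈ A → x ≢ 0ℤ → x ∈ ｛ -1ℤ ｝ ∪ (X ∪ ｛ m ｝)
    src (inj₁ (q , _))           x≢0 = map₂ inj₁ (source q x≢0)
    src (inj₂ (inj₁ refl))       x≢0 = contradiction refl x≢0
    src (inj₂ (inj₂ (refl , _))) x≢0 = inj₂ (inj₂ refl)
    snk : ∀ {y} → (-1ℤ , y) ∈ A → y ≡ -1ℤ
    snk (inj₁ (q , _))           = sink q
    snk (inj₂ (inj₂ (refl , _))) = contradiction 1≤m -1∉Positive

  arrows-confined : ∀ {φ} {d : DBI φ} (l : Labelling d) j → Confined (D l) (arrows l j)
  arrows-confined (Bξ {i} m 1≤m) j with j Fin.≟ i
  ... | yes _ = record
    { source = λ { (inj₁ refl)        x≢0 → contradiction refl x≢0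
                 ; (inj₂ (inj₁ refl)) _   → inj₂ refl
                 ; (inj₂ (inj₂ refl)) _   → inj₁ refl }
    ; sink   = λ { (inj₂ (inj₁ refl)) → contradiction 1≤m -1∉Positive
                 ; (inj₂ (inj₂ refl)) → refl }
    }
  ... | no _ = record
    { source = λ { (inj₁ refl)        x≢0 → contradiction refl x≢0
                 ; (inj₂ (inj₁ refl)) _   → inj₂ refl
                 ; (inj₂ (inj₂ refl)) _   → inj₁ refl }
    ; sink   = λ { (inj₂ (inj₁ refl)) → refl
                 ; (inj₂ (inj₂ refl)) → refl }
    }
  arrows-confined (Bξ∧ {i} l m 1≤m _) j =
    prefix-confined i (arrows l) j 1≤m (arrows-confined l j)
  arrows-confined (B {i} l m 1≤m _) j =
    prefix-confined i (arrows l) j 1≤m (arrows-confined l j)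
  arrows-confined (conj l l′ _) j = record
    { source = λ { (inj₁ (q , _))                   x≢0 → map₂ inj₁ (C.source q x≢0)
                 ; (inj₂ (inj₁ (q , _)))            x≢0 → map₂ inj₂ (C′.source q x≢0)
                 ; (inj₂ (inj₂ (inj₁ (x≡0 , _))))   x≢0 → contradiction x≡0 x≢0
                 ; (inj₂ (inj₂ (inj₂ (x≡0 , _))))   x≢0 → contradiction x≡0 x≢0 }
    ; sink   = λ { (inj₁ (q , _))        → C.sink q
                 ; (inj₂ (inj₁ (q , _))) → C′.sink q
                 ; (inj₂ (inj₂ (inj₁ (() , _))))
                 ; (inj₂ (inj₂ (inj₂ (() , _)))) }
    }
    where
    module C  = Confined (arrows-confined l j)
    module C′ = Confined (arrows-confined l′ j)

  -- Positive successors of event 0 and target agents.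

  prefix-initial-arrow : ∀ {i m} (Q : Agent → Arrows) {j k} → Positive m → Positive k →
                         (0ℤ , k) ∈ prefix i m Q j → i ≡ j
  prefix-initial-arrow {i} Q {j} 1≤m 1≤k q with j Fin.≟ i
  prefix-initial-arrow Q 1≤m 1≤k q | yes refl = refl
  prefix-initial-arrow Q 1≤m 1≤k (inj₁ (_ , 0≢0 , _)) | no _ = contradiction refl 0≢0
  prefix-initial-arrow Q 1≤m 1≤k (inj₂ (inj₁ refl)) | no _ = contradiction 1≤k -1∉Positive
  prefix-initial-arrow Q 1≤m 1≤k (inj₂ (inj₂ (refl , _))) | no _ = contradiction 1≤m 0∉Positive

  -- Turns the syntactic condition on `ta` in `Normal` into a statement about the graph. An agent
  -- outside `ta φ` can only go from 0 to -1, which the positivity of `k` rules out.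
  initial-arrow⇒ta : ∀ {φ} {d : DBI φ} (l : Labelling d) {j k} →
                     (0ℤ , k) ∈ arrows l j → Positive k → j ∈ ta φ
  initial-arrow⇒ta (Bξ {i} m _) {j} q 1≤k with j Fin.≟ i
  initial-arrow⇒ta (Bξ m _) q 1≤k | yes refl = refl
  initial-arrow⇒ta (Bξ m _) (inj₁ refl) 1≤k | no _ = contradiction 1≤k -1∉Positive
  initial-arrow⇒ta (Bξ m _) (inj₂ (inj₁ refl)) 1≤k | no _ = contradiction 1≤k -1∉Positive
  initial-arrow⇒ta (Bξ∧ l m 1≤m _) q 1≤k = prefix-initial-arrow (arrows l) 1≤m 1≤k q
  initial-arrow⇒ta (B l m 1≤m _)   q 1≤k = prefix-initial-arrow (arrows l) 1≤m 1≤k q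
  initial-arrow⇒ta (conj l l′ _) (inj₁ (_ , 0≢0 , _)) 1≤k = contradiction refl 0≢0
  initial-arrow⇒ta (conj l l′ _) (inj₂ (inj₁ (_ , 0≢0 , _))) 1≤k = contradiction refl 0≢0
  initial-arrow⇒ta (conj l l′ _) (inj₂ (inj₂ (inj₁ (_ , inj₁ q , _)))) 1≤k =
    inj₁ (initial-arrow⇒ta l q 1≤k)
  initial-arrow⇒ta (conj l l′ _) (inj₂ (inj₂ (inj₁ (_ , inj₂ q , _)))) 1≤k =
    inj₂ (initial-arrow⇒ta l′ q 1≤k)
  initial-arrow⇒ta (conj l l′ _) (inj₂ (inj₂ (inj₂ (_ , refl , _)))) 1≤k =
    contradiction 1≤k -1∉Positive

  -- Functionality of the arrows.

  fresh-no-arrow : ∀ {X A m y} → Confined X A → Positive m → m ∉ X → (m , y) ∉ avoid0 A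
  fresh-no-arrow c 1≤m m∉X (q , m≢0 , _) with Confined.source c q m≢0
  ... | inj₁ refl = -1∉Positive 1≤m
  ... | inj₂ m∈X  = m∉X m∈X

  -- The old arrows that are kept start neither at 0, by `avoid0`, nor at the fresh `m`, so they
  -- never compete with the new ones. For `j` other than `i`, the arrows from `m` copy those of
  -- `Q j` from 0 and inherit their functionality.
  prefix-functional : ∀ i {m} Q j {X} → Positive m → m ∉ X → Confined X (Q j) →
                      Functional (Q j) → Functional (prefix i m Q j)
  prefix-functional i {m} Q j {X} 1≤m m∉X c fun with j Fin.≟ i
  ... | yes _ = f
    where
    f : Functional (avoid0 (Q j) ∪ ｛ 0ℤ , m ｝ ∪ ｛ m , m ｝)
    f (inj₁ (q , _))         (inj₁ (r , _))         = fun q r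
    f (inj₁ (_ , x≢0 , _))   (inj₂ (inj₁ refl))     = contradiction refl x≢0
    f (inj₁ q)               (inj₂ (inj₂ refl))     = contradiction q (fresh-no-arrow c 1≤m m∉X)
    f (inj₂ (inj₁ refl))     (inj₁ (_ , x≢0 , _))   = contradiction refl x≢0
    f (inj₂ (inj₂ refl))     (inj₁ q)               = contradiction q (fresh-no-arrow c 1≤m m∉X)
    f (inj₂ (inj₁ refl))     (inj₂ (inj₁ refl))     = refl
    -- The sources would force `m` to be 0, but both arrows end at `m`, so the targets agree without
    -- refuting this.
    f (inj₂ (inj₁ refl))     (inj₂ (inj₂ refl))     = refl
    f (inj₂ (inj₂ refl))     (inj₂ (inj₁ refl))     = refl
    f (inj₂ (inj₂ refl))     (inj₂ (inj₂ refl))     = refl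
  ... | no _ = f
    where
    f : Functional (avoid0 (Q j) ∪ ｛ 0ℤ , -1ℤ ｝ ∪ λ (x , k) → x ≡ m × (0ℤ , k) ∈ Q j)
    f (inj₁ (q , _))           (inj₁ (r , _))           = fun q r
    f (inj₁ (_ , x≢0 , _))     (inj₂ (inj₁ refl))       = contradiction refl x≢0
    f (inj₁ q)                 (inj₂ (inj₂ (refl , _))) = contradiction q (fresh-no-arrow c 1≤m m∉X)
    f (inj₂ (inj₁ refl))       (inj₁ (_ , x≢0 , _))     = contradiction refl x≢0
    f (inj₂ (inj₂ (refl , _))) (inj₁ q)                 = contradiction q (fresh-no-arrow c 1≤m m∉X)
    f (inj₂ (inj₁ refl))       (inj₂ (inj₁ refl))       = refl
    f (inj₂ (inj₁ refl))       (inj₂ (inj₂ (refl , _))) = contradiction 1≤m 0∉Positive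
    f (inj₂ (inj₂ (refl , _))) (inj₂ (inj₁ refl))       = contradiction 1≤m 0∉Positive
    f (inj₂ (inj₂ (_ , q)))    (inj₂ (inj₂ (_ , r)))    = fun q r

  arrows-functional : ∀ {φ} (d : DBI φ) → Normal d → (l : Labelling d) (j : Agent) →
                      Functional (arrows l j)
  arrows-functional (Bξ i _) _ (Bξ m 1≤m) j with j Fin.≟ i
  ... | yes _ = λ
    { (inj₁ refl)        (inj₁ refl)        → refl
    ; (inj₁ refl)        (inj₂ (inj₁ refl)) → refl
    ; (inj₂ (inj₁ refl)) (inj₁ refl)        → refl
    ; (inj₂ (inj₁ refl)) (inj₂ (inj₁ refl)) → refl
    ; (inj₂ (inj₁ refl)) (inj₂ (inj₂ refl)) → refl
    ; (inj₂ (inj₂ refl)) (inj₂ (inj₁ refl)) → refl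
    ; (inj₂ (inj₂ refl)) (inj₂ (inj₂ refl)) → refl }
  ... | no _ = λ q r → trans (to-1 q) (sym (to-1 r))
    where
    to-1 : ∀ {x y} → (x , y) ∈ ｛ 0ℤ , -1ℤ ｝ ∪ ｛ m , -1ℤ ｝ ∪ ｛ -1ℤ , -1ℤ ｝ → y ≡ -1ℤ
    to-1 (inj₁ refl)        = refl
    to-1 (inj₂ (inj₁ refl)) = refl
    to-1 (inj₂ (inj₂ refl)) = refl
  arrows-functional (Bξ∧ i _ d) (normal , _) (Bξ∧ l m 1≤m m∉D) j =
    prefix-functional i (arrows l) j 1≤m m∉D (arrows-confined l j)
      (arrows-functional d normal l j)
  arrows-functional (B i d) (normal , _) (B l m 1≤m m∉D) j =
    prefix-functional i (arrows l) j 1≤m m∉D (arrows-confined l j)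
      (arrows-functional d normal l j)
  arrows-functional (d ∧ e) (normal , normal′ , ta⊥ta) (conj l l′ D⊥D) j = f
    where
    module C  = Confined (arrows-confined l j)
    module C′ = Confined (arrows-confined l′ j)

    -- The label sets are disjoint and positive, so a nonzero source common to both halves must be
    -- -1, which both send to -1.
    across : ∀ {x y z} → (x , y) ∈ avoid0 (arrows l j) →
             (x , z) ∈ avoid0 (arrows l′ j) → y ≡ z
    across (q , x≢0 , _) (r , _) with C.source q x≢0 | C′.source r x≢0
    ... | inj₁ refl | _         = trans (C.sink q) (sym (C′.sink r))
    ... | inj₂ x∈D  | inj₁ refl = contradiction (D⊆Positive l x∈D) -1∉Positive
    ... | inj₂ x∈D  | inj₂ x∈D′ = ⊥-elim (D⊥D (x∈D , x∈D′))

    -- Two positive successors of 0, one from each half, would put `j` into the target agents of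
    -- both conjuncts, against normality.
    clash : ∀ {y z} → (0ℤ , y) ∈ arrows l j → y ∈ D (conj l l′ D⊥D) →
            (0ℤ , z) ∈ arrows l′ j → z ∉ D (conj l l′ D⊥D)
    clash q y∈D r z∈D =
      ta⊥ta ( initial-arrow⇒ta l  q (D⊆Positive (conj l l′ D⊥D) y∈D)
            , initial-arrow⇒ta l′ r (D⊆Positive (conj l l′ D⊥D) z∈D))

    f : Functional (arrows (conj l l′ D⊥D) j)
    f (inj₁ (q , _)) (inj₁ (r , _)) = arrows-functional d normal l j q r
    f (inj₁ q) (inj₂ (inj₁ r)) = across q r
    f (inj₂ (inj₁ q)) (inj₁ r) = sym (across r q)
    f (inj₂ (inj₁ (q , _))) (inj₂ (inj₁ (r , _))) = arrows-functional e normal′ l′ j q r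
    f (inj₁ (_ , x≢0 , _)) (inj₂ (inj₂ (inj₁ (x≡0 , _)))) = contradiction x≡0 x≢0
    f (inj₁ (_ , x≢0 , _)) (inj₂ (inj₂ (inj₂ (x≡0 , _)))) = contradiction x≡0 x≢0
    f (inj₂ (inj₁ (_ , x≢0 , _))) (inj₂ (inj₂ (inj₁ (x≡0 , _)))) = contradiction x≡0 x≢0
    f (inj₂ (inj₁ (_ , x≢0 , _))) (inj₂ (inj₂ (inj₂ (x≡0 , _)))) = contradiction x≡0 x≢0
    f (inj₂ (inj₂ (inj₁ (x≡0 , _)))) (inj₁ (_ , x≢0 , _)) = contradiction x≡0 x≢0
    f (inj₂ (inj₂ (inj₂ (x≡0 , _)))) (inj₁ (_ , x≢0 , _)) = contradiction x≡0 x≢0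
    f (inj₂ (inj₂ (inj₁ (x≡0 , _)))) (inj₂ (inj₁ (_ , x≢0 , _))) = contradiction x≡0 x≢0
    f (inj₂ (inj₂ (inj₂ (x≡0 , _)))) (inj₂ (inj₁ (_ , x≢0 , _))) = contradiction x≡0 x≢0
    f (inj₂ (inj₂ (inj₁ (_ , inj₁ q , _)))) (inj₂ (inj₂ (inj₁ (_ , inj₁ r , _)))) =
      arrows-functional d normal l j q r
    f (inj₂ (inj₂ (inj₁ (_ , inj₂ q , _)))) (inj₂ (inj₂ (inj₁ (_ , inj₂ r , _)))) =
      arrows-functional e normal′ l′ j q r
    f (inj₂ (inj₂ (inj₁ (_ , inj₁ q , y∈D)))) (inj₂ (inj₂ (inj₁ (_ , inj₂ r , z∈D)))) =
      ⊥-elim (clash q y∈D r z∈D)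
    f (inj₂ (inj₂ (inj₁ (_ , inj₂ q , y∈D)))) (inj₂ (inj₂ (inj₁ (_ , inj₁ r , z∈D)))) =
      ⊥-elim (clash r z∈D q y∈D)
    -- The default arrow from 0 to -1 carries a proof that no target exists, which `t` contradicts.
    f (inj₂ (inj₂ (inj₁ (_ , t)))) (inj₂ (inj₂ (inj₂ (_ , _ , none)))) =
      contradiction (_ , t) none
    f (inj₂ (inj₂ (inj₂ (_ , _ , none)))) (inj₂ (inj₂ (inj₁ (_ , t)))) =
      contradiction (_ , t) none
    f (inj₂ (inj₂ (inj₂ (_ , y≡-1 , _)))) (inj₂ (inj₂ (inj₂ (_ , z≡-1 , _)))) =
      trans y≡-1 (sym z≡-1)

  -- Unique successors, and truth along a path in the update.

  SuccessorsUnique : ActionModel → Set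
  SuccessorsUnique U = ∀ i {β γ γ′} → Q i β γ → Q i β γ′ → γ ≡ γ′
    where open ActionModel U

  -- Arrows see only the integers, so functionality identifies those; irrelevance of membership then
  -- identifies the events.
  𝒰-successorsUnique : ∀ {φ} (d : DBI φ) → Normal d → (l : Labelling d) →
                       SuccessorsUnique (𝒰 l)
  𝒰-successorsUnique d normal l j {γ = _ , p} {γ′ = _ , p′} q q′
    with refl ← arrows-functional d normal l j q q′ = cong (_ ,_) (Events-irrelevant l p p′)

  -- A contradiction is stable, and a belief operator is a universal quantification, which preserves
  -- stability.
  B-seq-⊥-stable : ∀ {k ℓ} (is : Vec Agent k) (Mw : PointedModel ℓ) →
                   ¬ (Mw ⊭ B-seq is ⊥ᶠ) → Mw ⊨ B-seq is ⊥ᶠ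
  B-seq-⊥-stable [] Mw ¬¬⊥ = ⊥-elim (¬¬⊥ λ (p , ¬p) → ¬p p)
  B-seq-⊥-stable (i ∷ is) (M , w) ¬¬B u wRu =
    B-seq-⊥-stable is (M , u) λ u⊭ → ¬¬B λ w⊨ → u⊭ (w⊨ u wRu)

  module _ {ℓ : Level} (M : KripkeModel ℓ) (U : ActionModel)
           (unique : SuccessorsUnique U)
           (w : KripkeModel.S M) (α₀ : ActionModel.E U)
           (w⊨pre : (M , w) ⊨ ActionModel.pre U α₀) where
    open ActionModel U using (E; Q; pre)

    M⊙U : KripkeModel ℓ
    M⊙U = proj₁ ((M , w) ⊙ (U , α₀) ⟨ w⊨pre ⟩)

    Sᵁ⊆T : ∀ {xβ} → xβ ∈ Sᵁ M U w α₀ → xβ ∈ T M U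
    Sᵁ⊆T (base t)       = t
    Sᵁ⊆T (step _ t _ _) = t

    -- A successor `u` satisfying `pre α` yields the world `(u , α)` of the update, to which the
    -- belief at `(x , β)` applies. The generating point stays fixed while `(x , β)` moves along the
    -- path. The argument `s` is irrelevant because worlds store membership irrelevantly.
    B̂-nest⇒⊭ : ∀ {k} (is : Vec Agent (suc k)) (αs : Vec E (suc k)) {x β}
               .(s : (x , β) ∈ Sᵁ M U w α₀) → Path U β is αs →
               (M , x) ⊨ B̂-nest is (map pre αs) →
               (M⊙U , ((x , β) , [ s ])) ⊭ B-seq is ⊥ᶠ
    B̂-nest⇒⊭ (i ∷ []) (α ∷ []) s (βQα , _) x⊨ s⊨B =
      x⊨ λ u xRu u⊨pre →
        let p , ¬p = s⊨B ((u , α) , [ step s u⊨pre xRu βQα ]) (xRu , βQα) in ¬p p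
    B̂-nest⇒⊭ (i ∷ is@(_ ∷ _)) (α ∷ αs@(_ ∷ _)) s (βQα , path) x⊨ s⊨B =
      x⊨ λ u xRu (u⊨pre , u⊨nest) →
        B̂-nest⇒⊭ is αs (step s u⊨pre xRu βQα) path u⊨nest
          (s⊨B ((u , α) , [ step s u⊨pre xRu βQα ]) (xRu , βQα))

    -- Any successor in the update is some `(u , γ)` with `γ` a successor of `β`; uniqueness makes
    -- `γ` the event `α` on the path, and membership in the update gives `pre α` at `u`.
    ⊭⇒B̂-nest : ∀ {k} (is : Vec Agent (suc k)) (αs : Vec E (suc k)) {x β}
               .(s : (x , β) ∈ Sᵁ M U w α₀) → Path U β is αs →
               (M⊙U , ((x , β) , [ s ])) ⊭ B-seq is ⊥ᶠ →
               (M , x) ⊨ B̂-nest is (map pre αs)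
    ⊭⇒B̂-nest (i ∷ []) (α ∷ []) s (βQα , _) s⊭ none =
      s⊭ λ { ((u , γ) , [ t ]) (xRu , βQγ) → case unique i βQα βQγ of λ where
        -- Since `t` is irrelevant, the truth of `pre α` at `u` may only be used to reach an
        -- absurdity.
        refl → contradiction-irr (Sᵁ⊆T t) (none u xRu) }
    ⊭⇒B̂-nest (i ∷ is@(_ ∷ _)) (α ∷ αs@(_ ∷ _)) s (βQα , path) s⊭ none =
      s⊭ λ { ((u , γ) , [ t ]) (xRu , βQγ) → case unique i βQα βQγ of λ where
        -- Stability allows assuming that the remaining belief sequence fails at `(u , α)`, as the
        -- induction hypothesis requires.
        refl → B-seq-⊥-stable is (M⊙U , ((u , α) , [ t ])) λ t⊭ →
          contradiction-irr (Sᵁ⊆T t) λ u⊨pre →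
            none u xRu (u⊨pre , ⊭⇒B̂-nest is αs t path t⊭) }

theorem6 : (n : ℕ) → n > 1 → (Atom : Set) (p₀ : Atom) →
    let open Doxastic n Atom p₀ in
    {φ : Formula} (d : DBI φ) → Normal d → (l : Labelling d) →
    let open ActionModel (𝒰 l) in
    (k : ℕ) (is : Vec Agent (suc k)) → Linked _≢_ is →
    (αs : Vec E (suc k)) → Path (𝒰 l) (event0 l) is αs →
    {ℓ : Level} (M : KripkeModel ℓ) (v : KripkeModel.S M) →
    ((M , v) ⊨ B̂-nest is (map pre αs))
    ⇔ ((M , v) ⊙ (𝒰 l , event0 l) ⟨ ⊨⊤ᶠ (M , v) ⟩ ⊭ B-seq is ⊥ᶠ)
theorem6 n n>1 Atom p₀ d normal l k is linked αs path M v =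
  -- With `base`, the moving world starts at the point of the update.
  mk⇔ (B̂-nest⇒⊭ M (𝒰 l) unique v (event0 l) v⊨⊤ is αs (base v⊨⊤) path)
      (⊭⇒B̂-nest M (𝒰 l) unique v (event0 l) v⊨⊤ is αs (base v⊨⊤) path)
  where
  open Doxastic n Atom p₀
  unique : SuccessorsUnique (𝒰 l)
  unique = 𝒰-successorsUnique d normal l
  v⊨⊤ : (M , v) ⊨ ⊤ᶠ
  v⊨⊤ = ⊨⊤ᶠ (M , v)
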